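{- For every $\epsilon\in(0,0.5]$ there exists an instance of the $(1,\epsilon)$-restricted max-min fair allocation problem, with $4$ agents and $6$ items, for which $T^*=2\epsilon$ and $\mathsf{OPT}=\epsilon$. Consequently the integrality gap of the configuration-LP for the $(1,\epsilon)$-restricted max-min fair allocation problem is (unconditionally) at least $2$.
   Context: $(1,\epsilon)$-restricted max-min fair allocation problem: an instance consists of a finite set $A$ of agents, a finite set $B$ of indivisible items, a weight $w_j\in\{1,\epsilon\}$ for each item $j\in B$, and for each agent $i\in A$ a set $B_i\subseteq B$ of items that $i$ is interested in. The utility of item $j$ for agent $i$ is $w_{ij}=w_j$ if $j\in B_i$ and $w_{ij}=0$ otherwise. An allocation is a map $\sigma:B\to A$; $\mathsf{OPT}$ is the maximum over all allocations $\sigma$ of $\min_{i\in A}\sum_{j\in\sigma^{ -1}(i)}w_{ij}$. For $S\subseteq B$ let $w(S)=\sum_{j\in S}w_j$. For $T>0$ and $i\in A$ let $C(i,T)=\{S\subseteq B_i: w(S)\ge T\}$. The configuration-LP $\mathsf{CLP}(T)$ is the feasibility linear program in variables $x_{i,S}\ge 0$ ($i\in A$, $S\in C(i,T)$) with constraints $$\sum_{S\in C(i,T)}x_{i,S}\ge 1\quad\text{for all } i\in A,\qquad \sum_{i\in A}\ \sum_{S\in C(i,T):\, j\in S}x_{i,S}\le 1\quad\text{for all } j\in B.$$ $T^*$ denotes the maximum value such that $\mathsf{CLP}(T^*)$ is feasible. The ratio $T^*/\mathsf{OPT}$ is the integrality gap of the instance; the integrality gap for the problem is the supremum of this ratio over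 instances. -}

module Defs where

open import Algebra.Bundles using (CommutativeRing)
open import Algebra.Core using (Op₁; Op₂)
open import Algebra.Definitions using (Congruent₁)
open import Algebra.Structures using (IsCommutativeRing)
open import Data.Bool.Base using (if_then_else_)
open import Data.Fin.Base using (Fin)
open import Data.Fin.Properties using (_≟_)
open import Data.Fin.Subset using (Subset; inside; outside; _⊆_)
open import Data.Fin.Subset.Properties using (_∈?_; _⊆?_)
open import Data.Nat.Base using (ℕ; zero; suc)
open import Data.Product.Base using (∃-syntax; _×_)
open import Data.Sum.Base using (_⊎_)
open import Data.Vec.Base using ([]; _∷_)
open import Level using (Level; _⊔_) renaming (suc to lsuc)
open import Relation.Binary.Core using (Rel)
open import Relation.Binary.Bundles using (DecTotalOrder)
open import Relation.Binary.Structures using (IsDecTotalOrder)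
import Relation.Binary.Construct.NonStrictToStrict as ToStrict
open import Relation.Nullary.Decidable.Core using (Dec; does; _×-dec_)
open import Relation.Nullary.Negation.Core using (¬_)
open import Relation.Unary using (Pred)

-- The scalars.  The (classical) real numbers are a model, and so is ℚ.
-- Completeness is deliberately not assumed.

record OrderedField (c ℓ₁ ℓ₂ : Level) : Set (lsuc (c ⊔ ℓ₁ ⊔ ℓ₂)) where
  infix  8 _⁻¹ -_
  infixl 7 _*_ _/_
  infixl 6 _+_
  infix  4 _≈_ _≤_
  field
    Carrier           : Set c
    _≈_               : Rel Carrier ℓ₁
    _≤_               : Rel Carrier ℓ₂
    _+_ _*_           : Op₂ Carrier
    -_ _⁻¹            : Op₁ Carrier
    0# 1#             : Carrier
    isCommutativeRing : IsCommutativeRing _≈_ _+_ _*_ -_ 0# 1#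
    isDecTotalOrder   : IsDecTotalOrder _≈_ _≤_
    0≉1               : ¬ (0# ≈ 1#)
    -- The value of 0# ⁻¹ is left unspecified.
    ⁻¹-cong           : Congruent₁ _≈_ _⁻¹
    ⁻¹-inverseʳ       : ∀ x → ¬ (x ≈ 0#) → x * x ⁻¹ ≈ 1#
    +-monoˡ-≤         : ∀ z {x y} → x ≤ y → x + z ≤ y + z
    *-nonneg          : ∀ {x y} → 0# ≤ x → 0# ≤ y → 0# ≤ x * y

  commutativeRing : CommutativeRing c ℓ₁
  commutativeRing = record { isCommutativeRing = isCommutativeRing }

  decTotalOrder : DecTotalOrder c ℓ₁ ℓ₂
  decTotalOrder = record { isDecTotalOrder = isDecTotalOrder }

  open IsDecTotalOrder isDecTotalOrder public using (_≤?_)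
  open ToStrict _≈_ _≤_ public using (_<_)

  _/_ : Op₂ Carrier
  x / y = x * y ⁻¹

  2# : Carrier
  2# = 1# + 1#

module MaxMinAllocation {c ℓ₁ ℓ₂ : Level} (F : OrderedField c ℓ₁ ℓ₂) where

  open OrderedField F
  open import Algebra.Properties.Monoid.Sum
    (CommutativeRing.+-monoid commutativeRing) using (sum-syntax)

  IsMinimum IsMaximum : ∀ {ℓ} → Pred Carrier ℓ → Pred Carrier (c ⊔ ℓ₁ ⊔ ℓ₂ ⊔ ℓ)
  IsMinimum P v = (∃[ x ] P x × v ≈ x) × (∀ x → P x → v ≤ x)
  IsMaximum P v = (∃[ x ] P x × v ≈ x) × (∀ x → P x → x ≤ v)

  -- v ≤sup P says that v is at most the supremum of P, where the supremum
  -- may be +∞ and need not be represented by an element of F: v is at most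
  -- every upper bound of P.
  _≤sup_ : ∀ {ℓ} → Carrier → Pred Carrier ℓ → Set (c ⊔ ℓ₂ ⊔ ℓ)
  v ≤sup P = ∀ u → (∀ x → P x → x ≤ u) → v ≤ u

  -- The term x of a sum, kept only if the condition holds.
  [_]·_ : ∀ {p} {P : Set p} → Dec P → Carrier → Carrier
  [ P? ]· x = if does P? then x else 0#

  -- The sum of f S over all subsets S of Fin m.
  ∑⊆ : ∀ {m} → (Subset m → Carrier) → Carrier
  ∑⊆ {zero}  f = f []
  ∑⊆ {suc m} f = ∑⊆ (λ S → f (outside ∷ S)) + ∑⊆ (λ S → f (inside ∷ S))

  record Instance (ε : Carrier) (n m : ℕ) : Set (c ⊔ ℓ₁) where
    field
      weight      : Fin m → Carrier
      weight-1⊎ε  : ∀ j → weight j ≈ 1# ⊎ weight j ≈ ε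
      interesting : Fin n → Subset m

  module _ {ε : Carrier} {n m : ℕ} (I : Instance ε n m) where
    open Instance I

    itemUtility : Fin n → Fin m → Carrier
    itemUtility i j = [ j ∈? interesting i ]· weight j

    Allocation : Set
    Allocation = Fin m → Fin n

    agentUtility : Allocation → Fin n → Carrier
    agentUtility σ i = ∑[ j < m ] ([ σ j ≟ i ]· itemUtility i j)

    IsMinUtility : Allocation → Pred Carrier (c ⊔ ℓ₁ ⊔ ℓ₂)
    IsMinUtility σ = IsMinimum (λ u → ∃[ i ] u ≈ agentUtility σ i)

    IsOPT : Pred Carrier (c ⊔ ℓ₁ ⊔ ℓ₂)
    IsOPT = IsMaximum (λ v → ∃[ σ ] IsMinUtility σ v)

    totalWeight : Subset m → Carrier
    totalWeight S = ∑[ j < m ] ([ j ∈? S ]· weight j)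

    Configuration : Fin n → Carrier → Pred (Subset m) ℓ₂
    Configuration i T S = S ⊆ interesting i × T ≤ totalWeight S

    configuration? : ∀ i T S → Dec (Configuration i T S)
    configuration? i T S = (S ⊆? interesting i) ×-dec (T ≤? totalWeight S)

    -- The entries x i S with S not in C(i,T) are not variables of CLP(T);
    -- no constraint refers to them.
    record CLP-Solution (T : Carrier) (x : Fin n → Subset m → Carrier)
                        : Set (c ⊔ ℓ₂) where
      field
        nonneg : ∀ i S → Configuration i T S → 0# ≤ x i S
        agents : ∀ i → 1# ≤ ∑⊆ (λ S → [ configuration? i T S ]· x i S)
        items  : ∀ j → ∑[ i < n ] ∑⊆ (λ S →
                   [ configuration? i T S ×-dec (j ∈? S) ]· x i S) ≤ 1#

    CLP-Feasible : Pred Carrier (c ⊔ ℓ₂)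
    CLP-Feasible T = ∃[ x ] CLP-Solution T x

    IsT* : Pred Carrier (c ⊔ ℓ₁ ⊔ ℓ₂)
    IsT* = IsMaximum (λ T → 0# < T × CLP-Feasible T)

    -- r is the ratio T*/OPT of the instance; instances with OPT = 0 have none.
    IsIntegralityGapOf : Pred Carrier (c ⊔ ℓ₁ ⊔ ℓ₂)
    IsIntegralityGapOf r =
      ∃[ t ] ∃[ o ] IsT* t × IsOPT o × 0# < o × r ≈ t / o

  -- The ratios whose supremum is the integrality gap of the (1,ε)-restricted
  -- problem.
  IntegralityGaps : Carrier → Pred Carrier (c ⊔ ℓ₁ ⊔ ℓ₂)
  IntegralityGaps ε r =
    ∃[ n ] ∃[ m ] ∃[ I ] IsIntegralityGapOf {ε} {n} {m} I r

{-# OPTIONS --safe #-}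

-- Agents 0F and 1F compete for the item 0F of weight 1, agents 2F and 3F for
-- the item 1F of weight 1. The four items of weight ε form a 2 × 2 square;
-- 0F and 1F are also interested in its rows, 2F and 3F in its columns. Giving
-- every agent one half of its big item and one half of its pair solves CLP(2ε),
-- while for T > 2ε both 0F and 1F would need the whole item 0F. In an
-- allocation, some agent of {0F, 1F} and some agent of {2F, 3F} go without a
-- big item; the row and the column they want meet, so one of them gets at most
-- ε.
module Submission where

open import Defs
open import Algebra.Bundles using (CommutativeRing)
import Algebra.Properties.CommutativeMonoid.Sum as CommutativeMonoidSum
import Algebra.Properties.CommutativeSemigroup as CommutativeSemigroupProperties
import Algebra.Properties.Monoid.Mult as MonoidMult
import Algebra.Properties.Ring as RingProperties
open import Data.Bool.Base using (true; false)
import Data.Bool.Properties as Bool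
open import Data.Fin.Base using (Fin; zero; suc)
open import Data.Fin.Patterns using (0F; 1F; 2F; 3F; 4F; 5F)
open import Data.Fin.Properties using (_≟_)
open import Data.Fin.Subset using (Subset; inside; outside; _∈_; _⊆_; _∪_; ⁅_⁆; ∣_∣)
open import Data.Fin.Subset.Properties
  using (_∈?_; x∈⁅x⁆; x∈⁅y⁆⇒x≡y; x∈p∪q⁻; p⊆p∪q; q⊆p∪q)
open import Data.Nat.Base as ℕ using (ℕ)
open import Data.Product.Base using (_×_; Σ-syntax; ∃-syntax; _,_; proj₁; proj₂)
open import Data.Sum.Base using (_⊎_; inj₁; inj₂)
open import Data.Vec.Base using ([]; _∷_; tabulate)
open import Data.Vec.Properties using (≡-dec)
open import Function.Base using (_∘_)
open import Level using (Level)
open import Relation.Binary.Bundles using (DecTotalOrder)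
open import Relation.Binary.Definitions using (DecidableEquality)
open import Relation.Binary.PropositionalEquality as ≡ using (_≡_; _≢_)
import Relation.Binary.Reasoning.PartialOrder as PartialOrderReasoning
open import Relation.Nullary.Decidable.Core using (Dec; yes; no; does; _×-dec_)
open import Relation.Nullary.Negation.Core using (¬_; contradiction)

_≟ˢ_ : ∀ {n} → DecidableEquality (Subset n)
_≟ˢ_ = ≡-dec Bool._≟_

-- Order, the element one half, and finite sums in an ordered field.

module OrderedFieldProperties {c ℓ₁ ℓ₂} (F : OrderedField c ℓ₁ ℓ₂) where

  open OrderedField F
  open CommutativeRing commutativeRing
    using (_-_; sym; trans; +-cong; +-assoc; +-comm; +-identityˡ; +-identityʳ;
           -‿cong; -‿inverseʳ; *-congˡ; *-assoc; *-identityˡ; *-identityʳ;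
           distribʳ; ring; +-commutativeMonoid)
    renaming (refl to ≈-refl)
  open RingProperties ring using (-‿distribˡ-*; -‿involutive)
  open DecTotalOrder decTotalOrder using (poset; total; antisym)
    renaming (refl to ≤-refl; trans to ≤-trans; reflexive to ≤-reflexive)
  open CommutativeMonoidSum +-commutativeMonoid
    using (sum; sum-replicate-zero)
  open PartialOrderReasoning poset

  +-mono-≤ : ∀ {x y u v} → x ≤ y → u ≤ v → x + u ≤ y + v
  +-mono-≤ {x} {y} {u} {v} x≤y u≤v = begin
    x + u ≤⟨ +-monoˡ-≤ u x≤y ⟩
    y + u ≈⟨ +-comm y u ⟩
    u + y ≤⟨ +-monoˡ-≤ y u≤v ⟩
    v + y ≈⟨ +-comm v y ⟩
    y + v ∎

  x≤x+y : ∀ {x y} → 0# ≤ y → x ≤ x + y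
  x≤x+y {x} {y} 0≤y = begin
    x      ≈⟨ +-identityʳ x ⟨
    x + 0# ≤⟨ +-mono-≤ ≤-refl 0≤y ⟩
    x + y  ∎

  y≤x+y : ∀ {x y} → 0# ≤ x → y ≤ x + y
  y≤x+y {x} {y} 0≤x = ≤-trans (x≤x+y 0≤x) (≤-reflexive (+-comm y x))

  -- If `1# ≤ 0#`, then `- 1#` is nonnegative, and `1#` is its square.
  0≤1 : 0# ≤ 1#
  0≤1 with total 0# 1#
  ... | inj₁ 0≤1 = 0≤1
  ... | inj₂ 1≤0 = begin
    0#            ≤⟨ *-nonneg 0≤-1 0≤-1 ⟩
    - 1# * - 1#   ≈⟨ -‿distribˡ-* 1# (- 1#) ⟨
    - (1# * - 1#) ≈⟨ -‿cong (*-identityˡ (- 1#)) ⟩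
    - - 1#        ≈⟨ -‿involutive 1# ⟩
    1#            ∎
    where
    0≤-1 : 0# ≤ - 1#
    0≤-1 = begin
      0#        ≈⟨ -‿inverseʳ 1# ⟨
      1# - 1#   ≤⟨ +-monoˡ-≤ (- 1#) 1≤0 ⟩
      0# - 1#   ≈⟨ +-identityˡ (- 1#) ⟩
      - 1#      ∎

  1≰0 : ¬ (1# ≤ 0#)
  1≰0 1≤0 = 0≉1 (antisym 0≤1 1≤0)

  2≰1 : ¬ (2# ≤ 1#)
  2≰1 2≤1 = 1≰0 (begin
    1#             ≈⟨ +-identityʳ 1# ⟨
    1# + 0#        ≈⟨ +-cong ≈-refl (-‿inverseʳ 1#) ⟨
    1# + (1# - 1#) ≈⟨ +-assoc 1# 1# (- 1#) ⟨
    2# - 1#        ≤⟨ +-monoˡ-≤ (- 1#) 2≤1 ⟩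
    1# - 1#        ≈⟨ -‿inverseʳ 1# ⟩
    0#             ∎)

  2≉0 : ¬ (2# ≈ 0#)
  2≉0 2≈0 = 1≰0 (≤-trans (x≤x+y 0≤1) (≤-reflexive 2≈0))

  2*x≈x+x : ∀ x → 2# * x ≈ x + x
  2*x≈x+x x = trans (distribʳ x 1# 1#) (+-cong (*-identityˡ x) (*-identityˡ x))

  ½ : Carrier
  ½ = 1# / 2#

  ½+½≈1 : ½ + ½ ≈ 1#
  ½+½≈1 = trans (+-cong (*-identityˡ _) (*-identityˡ _))
                (trans (sym (2*x≈x+x (2# ⁻¹))) (⁻¹-inverseʳ 2# 2≉0))

  -- The axioms do not relate `⁻¹` to the order directly, so the sign is found by doubling: `½ ≤ 0#`
  -- would give `1# ≤ 0#`.
  0≤½ : 0# ≤ ½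
  0≤½ with total 0# ½
  ... | inj₁ 0≤½ = 0≤½
  ... | inj₂ ½≤0 = contradiction 1≤0 1≰0
    where
    1≤0 : 1# ≤ 0#
    1≤0 = begin
      1#      ≈⟨ ½+½≈1 ⟨
      ½ + ½   ≤⟨ +-mono-≤ ½≤0 ½≤0 ⟩
      0# + 0# ≈⟨ +-identityˡ 0# ⟩
      0#      ∎

  x*y/y≈x : ∀ x y → ¬ (y ≈ 0#) → x * y / y ≈ x
  x*y/y≈x x y y≉0 =
    trans (*-assoc x y (y ⁻¹)) (trans (*-congˡ (⁻¹-inverseʳ y y≉0)) (*-identityʳ x))

  sum-mono-≤ : ∀ {n} {f g : Fin n → Carrier} → (∀ i → f i ≤ g i) → sum f ≤ sum g
  sum-mono-≤ {ℕ.zero}  f≤g = ≤-refl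
  sum-mono-≤ {ℕ.suc n} f≤g = +-mono-≤ (f≤g zero) (sum-mono-≤ (f≤g ∘ suc))

  sum-nonneg : ∀ {n} {f : Fin n → Carrier} → (∀ i → 0# ≤ f i) → 0# ≤ sum f
  sum-nonneg {n} 0≤f = ≤-trans (≤-reflexive (sym (sum-replicate-zero n))) (sum-mono-≤ 0≤f)

  term≤sum : ∀ {n} {f : Fin n → Carrier} → (∀ i → 0# ≤ f i) → ∀ i → f i ≤ sum f
  term≤sum 0≤f zero    = x≤x+y (sum-nonneg (0≤f ∘ suc))
  term≤sum 0≤f (suc i) = ≤-trans (term≤sum (0≤f ∘ suc) i) (y≤x+y (0≤f zero))

-- Conditional terms, counting sums, and sums over all subsets.

module ConditionalSums {c ℓ₁ ℓ₂} (F : OrderedField c ℓ₁ ℓ₂) where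

  open OrderedField F
  open MaxMinAllocation F
  open OrderedFieldProperties F
  open CommutativeRing commutativeRing
    using (sym; trans; reflexive; +-cong; +-congˡ; +-identityˡ; +-identityʳ;
           +-monoid; +-commutativeSemigroup; +-commutativeMonoid)
    renaming (refl to ≈-refl)
  open CommutativeSemigroupProperties +-commutativeSemigroup using (interchange)
  open DecTotalOrder decTotalOrder using () renaming (refl to ≤-refl; trans to ≤-trans)
  open CommutativeMonoidSum +-commutativeMonoid using (sum-syntax)
  open MonoidMult +-monoid using () renaming (_×_ to _×#_)

  private variable
    p q : Level
    P Q : Set p
    m n : ℕ

  []-yes : (P? : Dec P) {x : Carrier} → P → [ P? ]· x ≡ x
  []-yes (yes _) _ = ≡.refl
  []-yes (no ¬p) p = contradiction p ¬p

  []-nonneg : (P? : Dec P) {x : Carrier} → (P → 0# ≤ x) → 0# ≤ [ P? ]· x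
  []-nonneg (yes p) 0≤x = 0≤x p
  []-nonneg (no _)  _   = ≤-refl

  []-mono : (P? : Dec P) (Q? : Dec Q) {x : Carrier} → (Q → 0# ≤ x) → (P → Q) →
            [ P? ]· x ≤ [ Q? ]· x
  []-mono (yes _) (yes _) 0≤x _   = ≤-refl
  []-mono (yes p) (no ¬q) 0≤x P⇒Q = contradiction (P⇒Q p) ¬q
  []-mono (no _)  Q?      0≤x _   = []-nonneg Q? 0≤x

  []-cong : (P? : Dec P) {x y : Carrier} → (P → x ≈ y) → [ P? ]· x ≈ [ P? ]· y
  []-cong (yes p) x≈y = x≈y p
  []-cong (no _)  _   = ≈-refl

  []-+ : (P? : Dec P) {x y : Carrier} → [ P? ]· (x + y) ≈ [ P? ]· x + [ P? ]· y
  []-+ (yes _) = ≈-refl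
  []-+ (no _)  = sym (+-identityˡ 0#)

  []-comm : (P? : Dec P) (Q? : Dec Q) {x : Carrier} →
            [ P? ]· ([ Q? ]· x) ≡ [ Q? ]· ([ P? ]· x)
  []-comm (yes _) Q?      = ≡.refl
  []-comm (no _)  (yes _) = ≡.refl
  []-comm (no _)  (no _)  = ≡.refl

  -- Turns a sum into a count. For concrete membership tests the cardinality computes to a numeral,
  -- so weights and loads can later be checked by `≡.refl`.
  ∑-[]-const : ∀ {p} {P : Fin n → Set p} (P? : ∀ i → Dec (P i)) (x : Carrier) →
               ∑[ i < n ] ([ P? i ]· x) ≈ ∣ tabulate (does ∘ P?) ∣ ×# x
  ∑-[]-const {n = ℕ.zero}  P? x = ≈-refl
  ∑-[]-const {n = ℕ.suc n} P? x with does (P? zero)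
  ... | true  = +-congˡ (∑-[]-const (P? ∘ suc) x)
  ... | false = trans (+-identityˡ _) (∑-[]-const (P? ∘ suc) x)

  ∑⊆-cong : {f g : Subset m → Carrier} → (∀ S → f S ≈ g S) → ∑⊆ f ≈ ∑⊆ g
  ∑⊆-cong {m = ℕ.zero}  f≈g = f≈g []
  ∑⊆-cong {m = ℕ.suc m} f≈g = +-cong (∑⊆-cong (f≈g ∘ (outside ∷_))) (∑⊆-cong (f≈g ∘ (inside ∷_)))

  ∑⊆-distrib-+ : (f g : Subset m → Carrier) → ∑⊆ (λ S → f S + g S) ≈ ∑⊆ f + ∑⊆ g
  ∑⊆-distrib-+ {m = ℕ.zero}  f g = ≈-refl
  ∑⊆-distrib-+ {m = ℕ.suc m} f g =
    trans (+-cong (∑⊆-distrib-+ (f ∘ (outside ∷_)) (g ∘ (outside ∷_)))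
                  (∑⊆-distrib-+ (f ∘ (inside ∷_)) (g ∘ (inside ∷_))))
          (interchange _ _ _ _)

  ∑⊆-nonneg : {f : Subset m → Carrier} → (∀ S → 0# ≤ f S) → 0# ≤ ∑⊆ f
  ∑⊆-nonneg {m = ℕ.zero}  0≤f = 0≤f []
  ∑⊆-nonneg {m = ℕ.suc m} 0≤f =
    ≤-trans (∑⊆-nonneg (0≤f ∘ (outside ∷_))) (x≤x+y (∑⊆-nonneg (0≤f ∘ (inside ∷_))))

  ∑⊆-mono-≤ : {f g : Subset m → Carrier} → (∀ S → f S ≤ g S) → ∑⊆ f ≤ ∑⊆ g
  ∑⊆-mono-≤ {m = ℕ.zero}  f≤g = f≤g []
  ∑⊆-mono-≤ {m = ℕ.suc m} f≤g =
    +-mono-≤ (∑⊆-mono-≤ (f≤g ∘ (outside ∷_))) (∑⊆-mono-≤ (f≤g ∘ (inside ∷_)))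

  ∑⊆-zero : ∀ m → ∑⊆ {m} (λ _ → 0#) ≈ 0#
  ∑⊆-zero ℕ.zero    = ≈-refl
  ∑⊆-zero (ℕ.suc m) = trans (+-cong (∑⊆-zero m) (∑⊆-zero m)) (+-identityˡ 0#)

  -- The truth value of `≟ˢ` computes head by head: the half of the sum whose head differs from that
  -- of `A` reduces to zeros, and the induction continues in the other half.
  ∑⊆-δ : (A : Subset m) (f : Subset m → Carrier) → ∑⊆ (λ S → [ S ≟ˢ A ]· f S) ≈ f A
  ∑⊆-δ []            f = ≈-refl
  ∑⊆-δ {m = ℕ.suc m} (outside ∷ A) f =
    trans (+-cong (∑⊆-δ A (f ∘ (outside ∷_))) (∑⊆-zero m)) (+-identityʳ _)
  ∑⊆-δ {m = ℕ.suc m} (inside ∷ A)  f =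
    trans (+-cong (∑⊆-zero m) (∑⊆-δ A (f ∘ (inside ∷_)))) (+-identityˡ _)

  -- Evaluates the sums in the LP constraints at a solution supported on two sets. Exchanging the
  -- condition with the delta brings each summand into the form of `∑⊆-δ`.
  ∑⊆-[]-δδ : ∀ {p} {P : Subset m → Set p} (P? : ∀ S → Dec (P S)) (A B : Subset m) (x : Carrier) →
             ∑⊆ (λ S → [ P? S ]· ([ S ≟ˢ A ]· x + [ S ≟ˢ B ]· x)) ≈ [ P? A ]· x + [ P? B ]· x
  ∑⊆-[]-δδ P? A B x =
    trans (∑⊆-cong λ S → trans ([]-+ (P? S))
             (+-cong (reflexive ([]-comm (P? S) (S ≟ˢ A))) (reflexive ([]-comm (P? S) (S ≟ˢ B)))))
   (trans (∑⊆-distrib-+ (λ S → [ S ≟ˢ A ]· ([ P? S ]· x)) (λ S → [ S ≟ˢ B ]· ([ P? S ]· x)))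
          (+-cong (∑⊆-δ A (λ S → [ P? S ]· x)) (∑⊆-δ B (λ S → [ P? S ]· x))))

-- Bounds on weights and utilities in an arbitrary instance.

module InstanceProperties {c ℓ₁ ℓ₂} (F : OrderedField c ℓ₁ ℓ₂) where

  open OrderedField F
  open MaxMinAllocation F
  open OrderedFieldProperties F
  open ConditionalSums F
  open CommutativeRing commutativeRing using (trans; +-monoid; +-commutativeMonoid)
  open CommutativeMonoidSum +-commutativeMonoid using (sum-cong-≋)
  open MonoidMult +-monoid using () renaming (_×_ to _×#_)

  module _ {ε n m} (I : Instance ε n m) where
    open Instance I

    totalWeight-uniform : ∀ S {x} → (∀ j → j ∈ S → weight j ≈ x) →
                          totalWeight I S ≈ ∣ tabulate (does ∘ (_∈? S)) ∣ ×# x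
    totalWeight-uniform S {x} w≈x =
      trans (sum-cong-≋ λ j → []-cong (j ∈? S) (w≈x j)) (∑-[]-const (_∈? S) x)

    module _ (0≤weight : ∀ j → 0# ≤ weight j) where

      totalWeight-mono : ∀ {S S′} → S ⊆ S′ → totalWeight I S ≤ totalWeight I S′
      totalWeight-mono {S} {S′} S⊆S′ =
        sum-mono-≤ λ j → []-mono (j ∈? S) (j ∈? S′) (λ _ → 0≤weight j) S⊆S′

      -- The comparison is term by term: an item contributes only if `i` receives it and is
      -- interested in it, and then it lies in `S`.
      agentUtility≤totalWeight : ∀ σ i S → (∀ {j} → σ j ≡ i → j ∈ interesting i → j ∈ S) →
                                 agentUtility I σ i ≤ totalWeight I S
      agentUtility≤totalWeight σ i S got⇒∈S = sum-mono-≤ term≤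
        where
        term≤ : ∀ j → [ σ j ≟ i ]· itemUtility I i j ≤ [ j ∈? S ]· weight j
        term≤ j with σ j ≟ i
        ... | yes σj≡i = []-mono (j ∈? interesting i) (j ∈? S) (λ _ → 0≤weight j) (got⇒∈S σj≡i)
        ... | no  _    = []-nonneg (j ∈? S) (λ _ → 0≤weight j)

      weight≤agentUtility : ∀ σ {i} j → σ j ≡ i → j ∈ interesting i →
                            weight j ≤ agentUtility I σ i
      weight≤agentUtility σ {i} j σj≡i j∈ = ≡.subst (_≤ agentUtility I σ i)
        (≡.trans ([]-yes (σ j ≟ i) σj≡i) ([]-yes (j ∈? interesting i) j∈))
        (term≤sum (λ k → []-nonneg (σ k ≟ i) λ _ → []-nonneg (k ∈? interesting i) λ _ → 0≤weight k) j)

-- The instance with gap two.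

module GapInstance {c ℓ₁ ℓ₂} (F : OrderedField c ℓ₁ ℓ₂) where

  open OrderedField F
  open OrderedFieldProperties F

  module _ (ε : Carrier) (0<ε : 0# < ε) (ε≤½ : ε ≤ ½) where

    open MaxMinAllocation F
    open ConditionalSums F
    open InstanceProperties F
    open CommutativeRing commutativeRing
      using (sym; trans; reflexive; +-cong; +-congˡ; +-identityʳ; +-monoid; +-commutativeMonoid)
      renaming (refl to ≈-refl)
    open DecTotalOrder decTotalOrder using (poset; antisym)
      renaming (refl to ≤-refl; trans to ≤-trans; reflexive to ≤-reflexive)
    open CommutativeMonoidSum +-commutativeMonoid
      using (sum-syntax; sum-cong-≋; ∑-distrib-+)
    open MonoidMult +-monoid using (×-congˡ; ×-homo-1; ×-homo-+) renaming (_×_ to _×#_)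
    open PartialOrderReasoning poset

    -- The square is read row by row: its rows are `2F`, `3F` and `4F`, `5F`, its columns `2F`, `4F`
    -- and `3F`, `5F`.
    big small small′ : Fin 4 → Fin 6
    big 0F = 0F
    big 1F = 0F
    big 2F = 1F
    big 3F = 1F
    small 0F = 2F
    small 1F = 4F
    small 2F = 2F
    small 3F = 3F
    small′ 0F = 3F
    small′ 1F = 5F
    small′ 2F = 4F
    small′ 3F = 5F

    pair : Fin 4 → Subset 6
    pair i = ⁅ small i ⁆ ∪ ⁅ small′ i ⁆

    gapInstance : Instance ε 4 6
    gapInstance = record { weight = w ; weight-1⊎ε = w-1⊎ε ; interesting = λ i → ⁅ big i ⁆ ∪ pair i }
      where
      w : Fin 6 → Carrier
      w 0F            = 1#
      w 1F            = 1#
      w (suc (suc _)) = ε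
      w-1⊎ε : ∀ j → w j ≈ 1# ⊎ w j ≈ ε
      w-1⊎ε 0F            = inj₁ ≈-refl
      w-1⊎ε 1F            = inj₁ ≈-refl
      w-1⊎ε (suc (suc _)) = inj₂ ≈-refl

    open Instance gapInstance

    0≤ε : 0# ≤ ε
    0≤ε = proj₁ 0<ε

    2*ε≈ε+ε : 2# * ε ≈ ε + ε
    2*ε≈ε+ε = 2*x≈x+x ε

    -- Here `ε≤½` enters: it makes a big item alone worth at least as much as two small ones, hence
    -- a configuration for `2# * ε`.
    2*ε≤1 : 2# * ε ≤ 1#
    2*ε≤1 = begin
      2# * ε ≈⟨ 2*ε≈ε+ε ⟩
      ε + ε  ≤⟨ +-mono-≤ ε≤½ ε≤½ ⟩
      ½ + ½  ≈⟨ ½+½≈1 ⟩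
      1#     ∎

    ε≤2*ε : ε ≤ 2# * ε
    ε≤2*ε = ≤-trans (x≤x+y 0≤ε) (≤-reflexive (sym 2*ε≈ε+ε))

    0<2*ε : 0# < 2# * ε
    0<2*ε = ≤-trans 0≤ε ε≤2*ε ,
      λ 0≈2*ε → proj₂ 0<ε (antisym 0≤ε (≤-trans ε≤2*ε (≤-reflexive (sym 0≈2*ε))))

    0≤weight : ∀ j → 0# ≤ weight j
    0≤weight 0F            = 0≤1
    0≤weight 1F            = 0≤1
    0≤weight (suc (suc _)) = 0≤ε

    ε≤weight : ∀ j → ε ≤ weight j
    ε≤weight 0F            = ≤-trans ε≤2*ε 2*ε≤1
    ε≤weight 1F            = ≤-trans ε≤2*ε 2*ε≤1
    ε≤weight (suc (suc _)) = ≤-refl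

    weight-big : ∀ i → weight (big i) ≈ 1#
    weight-big 0F = ≈-refl
    weight-big 1F = ≈-refl
    weight-big 2F = ≈-refl
    weight-big 3F = ≈-refl

    weight-small : ∀ i → weight (small i) ≈ ε
    weight-small 0F = ≈-refl
    weight-small 1F = ≈-refl
    weight-small 2F = ≈-refl
    weight-small 3F = ≈-refl

    weight-small′ : ∀ i → weight (small′ i) ≈ ε
    weight-small′ 0F = ≈-refl
    weight-small′ 1F = ≈-refl
    weight-small′ 2F = ≈-refl
    weight-small′ 3F = ≈-refl

    big∈interesting : ∀ i → big i ∈ interesting i
    big∈interesting i = p⊆p∪q (pair i) (x∈⁅x⁆ (big i))

    small∈interesting : ∀ i → small i ∈ interesting i
    small∈interesting i = q⊆p∪q ⁅ big i ⁆ (pair i) (p⊆p∪q ⁅ small′ i ⁆ (x∈⁅x⁆ (small i)))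

    ∈interesting⁻ : ∀ i {j} → j ∈ interesting i → j ≡ big i ⊎ j ∈ pair i
    ∈interesting⁻ i j∈ with x∈p∪q⁻ ⁅ big i ⁆ (pair i) j∈
    ... | inj₁ j∈⁅big⁆ = inj₁ (x∈⁅y⁆⇒x≡y _ j∈⁅big⁆)
    ... | inj₂ j∈pair  = inj₂ j∈pair

    ∈pair⁻ : ∀ i {j} → j ∈ pair i → j ≡ small i ⊎ j ≡ small′ i
    ∈pair⁻ i j∈ with x∈p∪q⁻ ⁅ small i ⁆ ⁅ small′ i ⁆ j∈
    ... | inj₁ j∈⁅small⁆  = inj₁ (x∈⁅y⁆⇒x≡y _ j∈⁅small⁆)
    ... | inj₂ j∈⁅small′⁆ = inj₂ (x∈⁅y⁆⇒x≡y _ j∈⁅small′⁆)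

    totalWeight-⁅⁆ : ∀ j → totalWeight gapInstance ⁅ j ⁆ ≈ weight j
    totalWeight-⁅⁆ j = trans
      (totalWeight-uniform gapInstance ⁅ j ⁆ λ k k∈ → reflexive (≡.cong weight (x∈⁅y⁆⇒x≡y j k∈)))
      (trans (×-congˡ (count≡1 j)) (×-homo-1 (weight j)))
      where
      count≡1 : ∀ (j : Fin 6) → ∣ tabulate (λ k → does (k ∈? ⁅ j ⁆)) ∣ ≡ 1
      count≡1 0F = ≡.refl
      count≡1 1F = ≡.refl
      count≡1 2F = ≡.refl
      count≡1 3F = ≡.refl
      count≡1 4F = ≡.refl
      count≡1 5F = ≡.refl

    totalWeight-pair : ∀ i → totalWeight gapInstance (pair i) ≈ 2# * ε
    totalWeight-pair i = begin-equality
      totalWeight gapInstance (pair i)                   ≈⟨ totalWeight-uniform gapInstance (pair i) (weight-pair i) ⟩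
      ∣ tabulate (λ k → does (k ∈? pair i)) ∣ ×# ε       ≈⟨ ×-congˡ (count≡2 i) ⟩
      ε + (ε + 0#)                                       ≈⟨ +-congˡ (+-identityʳ ε) ⟩
      ε + ε                                              ≈⟨ 2*ε≈ε+ε ⟨
      2# * ε                                             ∎
      where
      weight-pair : ∀ i j → j ∈ pair i → weight j ≈ ε
      weight-pair i j j∈ with ∈pair⁻ i j∈
      ... | inj₁ ≡.refl = weight-small i
      ... | inj₂ ≡.refl = weight-small′ i
      -- Splitting on `i` closes the term, so the count evaluates; it is 2 because `small i` and
      -- `small′ i` are distinct.
      count≡2 : ∀ i → ∣ tabulate (λ k → does (k ∈? pair i)) ∣ ≡ 2
      count≡2 0F = ≡.refl
      count≡2 1F = ≡.refl
      count≡2 2F = ≡.refl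
      count≡2 3F = ≡.refl

    -- Feasibility of the configuration-LP at `2# * ε`.

    configuration-big : ∀ i → Configuration gapInstance i (2# * ε) ⁅ big i ⁆
    configuration-big i = p⊆p∪q (pair i) , (begin
      2# * ε                             ≤⟨ 2*ε≤1 ⟩
      1#                                 ≈⟨ weight-big i ⟨
      weight (big i)                     ≈⟨ totalWeight-⁅⁆ (big i) ⟨
      totalWeight gapInstance ⁅ big i ⁆  ∎)

    configuration-pair : ∀ i → Configuration gapInstance i (2# * ε) (pair i)
    configuration-pair i = q⊆p∪q ⁅ big i ⁆ (pair i) , ≤-reflexive (sym (totalWeight-pair i))

    half : Fin 4 → Subset 6 → Carrier
    half i S = [ S ≟ˢ ⁅ big i ⁆ ]· ½ + [ S ≟ˢ pair i ]· ½

    half-solution : CLP-Solution gapInstance (2# * ε) half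
    half-solution = record
      { nonneg = λ i S _ → ≤-trans ([]-nonneg (S ≟ˢ ⁅ big i ⁆) λ _ → 0≤½)
                                   (x≤x+y ([]-nonneg (S ≟ˢ pair i) λ _ → 0≤½))
      ; agents = λ i → ≤-reflexive (agent-load i)
      ; items  = item-load
      }
      where
      C? = configuration? gapInstance

      agent-load : ∀ i → 1# ≈ ∑⊆ (λ S → [ C? i (2# * ε) S ]· half i S)
      agent-load i = begin-equality
        1#                                          ≈⟨ ½+½≈1 ⟨
        ½ + ½                                       ≡⟨ ≡.cong₂ _+_ ([]-yes (C? i (2# * ε) ⁅ big i ⁆) (configuration-big i))
                                                                   ([]-yes (C? i (2# * ε) (pair i)) (configuration-pair i)) ⟨
        [ C? i (2# * ε) ⁅ big i ⁆ ]· ½ +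
        [ C? i (2# * ε) (pair i) ]· ½               ≈⟨ ∑⊆-[]-δδ (C? i (2# * ε)) ⁅ big i ⁆ (pair i) ½ ⟨
        ∑⊆ (λ S → [ C? i (2# * ε) S ]· half i S)    ∎

      bigs pairs : Fin 6 → ℕ
      bigs  j = ∣ tabulate (λ i → does (j ∈? ⁅ big i ⁆)) ∣
      pairs j = ∣ tabulate (λ i → does (j ∈? pair i)) ∣

      -- A big item is shared by two agents and lies in no pair; a small item is nobody's big item
      -- and lies in one row and one column.
      bigs+pairs≡2 : ∀ j → bigs j ℕ.+ pairs j ≡ 2
      bigs+pairs≡2 0F = ≡.refl
      bigs+pairs≡2 1F = ≡.refl
      bigs+pairs≡2 2F = ≡.refl
      bigs+pairs≡2 3F = ≡.refl
      bigs+pairs≡2 4F = ≡.refl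
      bigs+pairs≡2 5F = ≡.refl

      item-load : ∀ j → ∑[ i < 4 ] ∑⊆ (λ S → [ C? i (2# * ε) S ×-dec (j ∈? S) ]· half i S) ≤ 1#
      item-load j = begin
        ∑[ i < 4 ] ∑⊆ (λ S → [ C? i (2# * ε) S ×-dec (j ∈? S) ]· half i S)
          ≈⟨ sum-cong-≋ (λ i → ∑⊆-[]-δδ (λ S → C? i (2# * ε) S ×-dec (j ∈? S)) ⁅ big i ⁆ (pair i) ½) ⟩
        ∑[ i < 4 ] ([ C? i (2# * ε) ⁅ big i ⁆ ×-dec (j ∈? ⁅ big i ⁆) ]· ½ +
                    [ C? i (2# * ε) (pair i) ×-dec (j ∈? pair i) ]· ½)
          -- Dropping the configuration condition can only enlarge the sum, since `½` is
          -- nonnegative; what remains is a plain count of memberships.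
          ≤⟨ sum-mono-≤ (λ i → +-mono-≤ ([]-mono (C? i (2# * ε) ⁅ big i ⁆ ×-dec (j ∈? ⁅ big i ⁆)) (j ∈? ⁅ big i ⁆) (λ _ → 0≤½) proj₂)
                                        ([]-mono (C? i (2# * ε) (pair i) ×-dec (j ∈? pair i)) (j ∈? pair i) (λ _ → 0≤½) proj₂)) ⟩
        ∑[ i < 4 ] ([ j ∈? ⁅ big i ⁆ ]· ½ + [ j ∈? pair i ]· ½)
          ≈⟨ ∑-distrib-+ {4} (λ i → [ j ∈? ⁅ big i ⁆ ]· ½) (λ i → [ j ∈? pair i ]· ½) ⟩
        ∑[ i < 4 ] ([ j ∈? ⁅ big i ⁆ ]· ½) + ∑[ i < 4 ] ([ j ∈? pair i ]· ½)
          ≈⟨ +-cong (∑-[]-const {n = 4} (λ i → j ∈? ⁅ big i ⁆) ½) (∑-[]-const {n = 4} (λ i → j ∈? pair i) ½) ⟩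
        bigs j ×# ½ + pairs j ×# ½
          ≈⟨ ×-homo-+ ½ (bigs j) (pairs j) ⟨
        (bigs j ℕ.+ pairs j) ×# ½
          ≈⟨ ×-congˡ (bigs+pairs≡2 j) ⟩
        ½ + (½ + 0#)
          ≈⟨ +-congˡ (+-identityʳ ½) ⟩
        ½ + ½
          ≈⟨ ½+½≈1 ⟩
        1# ∎

    -- Infeasibility of the configuration-LP above `2# * ε`.

    heavy⇒big∈ : ∀ {T} → ¬ (T ≤ 2# * ε) → ∀ i S → Configuration gapInstance i T S → big i ∈ S
    heavy⇒big∈ {T} T≰2ε i S (S⊆ , T≤S) with big i ∈? S
    ... | yes big∈S = big∈S
    ... | no  big∉S = contradiction T≤2ε T≰2ε
      where
      -- Without the big item only the pair is left to `S`, and the pair weighs just `2# * ε`.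
      S⊆pair : S ⊆ pair i
      S⊆pair j∈S with ∈interesting⁻ i (S⊆ j∈S)
      ... | inj₁ ≡.refl = contradiction j∈S big∉S
      ... | inj₂ j∈pair = j∈pair
      T≤2ε : T ≤ 2# * ε
      T≤2ε = begin
        T                                ≤⟨ T≤S ⟩
        totalWeight gapInstance S        ≤⟨ totalWeight-mono gapInstance 0≤weight S⊆pair ⟩
        totalWeight gapInstance (pair i) ≈⟨ totalWeight-pair i ⟩
        2# * ε                           ∎

    feasible⇒≤2ε : ∀ T → CLP-Feasible gapInstance T → T ≤ 2# * ε
    feasible⇒≤2ε T (x , x-solution) with T ≤? 2# * ε
    ... | yes T≤2ε = T≤2ε
    ... | no  T≰2ε = contradiction 2≤1 2≰1
      where
      open CLP-Solution x-solution
      C? = configuration? gapInstance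

      load : Fin 4 → Fin 6 → Carrier
      load i j = ∑⊆ (λ S → [ C? i T S ×-dec (j ∈? S) ]· x i S)

      -- Every configuration of `i` contains `big i`, so the whole unit demanded by the constraint
      -- of agent `i` is charged to that item.
      1≤load-big : ∀ i → 1# ≤ load i (big i)
      1≤load-big i = ≤-trans (agents i) (∑⊆-mono-≤ λ S →
        []-mono (C? i T S) (C? i T S ×-dec (big i ∈? S)) (nonneg i S ∘ proj₁)
                (λ config → config , heavy⇒big∈ T≰2ε i S config))

      0≤load : ∀ i j → 0# ≤ load i j
      0≤load i j = ∑⊆-nonneg λ S → []-nonneg (C? i T S ×-dec (j ∈? S)) (nonneg i S ∘ proj₁)

      2≤1 : 2# ≤ 1#
      2≤1 = begin
        1# + 1#               ≤⟨ +-mono-≤ (1≤load-big 0F) (1≤load-big 1F) ⟩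
        load 0F 0F + load 1F 0F
          -- The constraint of item `0F` sums over all four agents; the loads of `2F` and `3F` are
          -- nonnegative and may be added.
          ≤⟨ +-mono-≤ ≤-refl (x≤x+y (sum-nonneg {2} λ i → 0≤load (suc (suc i)) 0F)) ⟩
        ∑[ i < 4 ] load i 0F  ≤⟨ items 0F ⟩
        1#                    ∎

    isT* : IsT* gapInstance (2# * ε)
    isT* = (2# * ε , (0<2*ε , half , half-solution) , ≈-refl) ,
           λ T (_ , feasible) → feasible⇒≤2ε T feasible

    -- The integral optimum is `ε`.

    deprived⇒utility≤ε : ∀ σ i → σ (big i) ≢ i → σ (small i) ≢ i ⊎ σ (small′ i) ≢ i →
                         agentUtility gapInstance σ i ≤ ε
    deprived⇒utility≤ε σ i ¬big (inj₁ ¬small) = begin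
      agentUtility gapInstance σ i          ≤⟨ agentUtility≤totalWeight gapInstance 0≤weight σ i ⁅ small′ i ⁆ got ⟩
      totalWeight gapInstance ⁅ small′ i ⁆  ≈⟨ totalWeight-⁅⁆ (small′ i) ⟩
      weight (small′ i)                     ≈⟨ weight-small′ i ⟩
      ε                                     ∎
      where
      -- With the big item and `small i` excluded, `small′ i` is the only item that can still
      -- contribute.
      got : ∀ {j} → σ j ≡ i → j ∈ interesting i → j ∈ ⁅ small′ i ⁆
      got σj≡i j∈ with ∈interesting⁻ i j∈
      ... | inj₁ ≡.refl = contradiction σj≡i ¬big
      ... | inj₂ j∈pair with ∈pair⁻ i j∈pair
      ... | inj₁ ≡.refl = contradiction σj≡i ¬small
      ... | inj₂ ≡.refl = x∈⁅x⁆ (small′ i)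
    deprived⇒utility≤ε σ i ¬big (inj₂ ¬small′) = begin
      agentUtility gapInstance σ i         ≤⟨ agentUtility≤totalWeight gapInstance 0≤weight σ i ⁅ small i ⁆ got ⟩
      totalWeight gapInstance ⁅ small i ⁆  ≈⟨ totalWeight-⁅⁆ (small i) ⟩
      weight (small i)                     ≈⟨ weight-small i ⟩
      ε                                    ∎
      where
      got : ∀ {j} → σ j ≡ i → j ∈ interesting i → j ∈ ⁅ small i ⁆
      got σj≡i j∈ with ∈interesting⁻ i j∈
      ... | inj₁ ≡.refl = contradiction σj≡i ¬big
      ... | inj₂ j∈pair with ∈pair⁻ i j∈pair
      ... | inj₁ ≡.refl = x∈⁅x⁆ (small i)
      ... | inj₂ ≡.refl = contradiction σj≡i ¬small′

    ≢-via : ∀ {n} {i j k : Fin n} → i ≡ j → j ≢ k → i ≢ k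
    ≢-via ≡.refl j≢k = j≢k

    -- The first two tests single out a row agent and a column agent without a big item. The third
    -- asks whether the row agent owns the cell where their row and column meet: if not, the row
    -- agent is deprived; if so, the column agent is.
    someone-deprived : ∀ (σ : Allocation gapInstance) →
                       ∃[ i ] σ (big i) ≢ i × (σ (small i) ≢ i ⊎ σ (small′ i) ≢ i)
    someone-deprived σ with σ 0F ≟ 0F | σ 1F ≟ 2F
    ... | no σ0≢0  | no σ1≢2  with σ 2F ≟ 0F
    ...   | no  σ2≢0 = 0F , σ0≢0 , inj₁ σ2≢0
    ...   | yes σ2≡0 = 2F , σ1≢2 , inj₁ (≢-via σ2≡0 λ ())
    someone-deprived σ | no σ0≢0  | yes σ1≡2 with σ 3F ≟ 0F
    ...   | no  σ3≢0 = 0F , σ0≢0 , inj₂ σ3≢0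
    ...   | yes σ3≡0 = 3F , (≢-via σ1≡2 λ ()) , inj₁ (≢-via σ3≡0 λ ())
    someone-deprived σ | yes σ0≡0 | no σ1≢2  with σ 4F ≟ 2F
    ...   | no  σ4≢2 = 2F , σ1≢2 , inj₂ σ4≢2
    ...   | yes σ4≡2 = 1F , (≢-via σ0≡0 λ ()) , inj₁ (≢-via σ4≡2 λ ())
    someone-deprived σ | yes σ0≡0 | yes σ1≡2 with σ 5F ≟ 1F
    ...   | no  σ5≢1 = 1F , (≢-via σ0≡0 λ ()) , inj₂ σ5≢1
    ...   | yes σ5≡1 = 3F , (≢-via σ1≡2 λ ()) , inj₂ (≢-via σ5≡1 λ ())

    minUtility≤ε : ∀ σ v → IsMinUtility gapInstance σ v → v ≤ ε
    minUtility≤ε σ v (_ , v≤) with someone-deprived σ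
    ... | i , ¬big , ¬small = ≤-trans (v≤ _ (i , ≈-refl)) (deprived⇒utility≤ε σ i ¬big ¬small)

    -- Agent `1F` gets `4F` alone, so that its utility is exactly `ε` and witnesses the minimum. The
    -- spare `5F` goes to `0F`, who has no interest in it.
    optimal : Allocation gapInstance
    optimal 0F = 0F
    optimal 1F = 2F
    optimal 2F = 0F
    optimal 3F = 3F
    optimal 4F = 1F
    optimal 5F = 0F

    ε≤optimal : ∀ i → ε ≤ agentUtility gapInstance optimal i
    ε≤optimal i = let j , σj≡i , j∈ = received i in
      ≤-trans (ε≤weight j) (weight≤agentUtility gapInstance 0≤weight optimal j σj≡i j∈)
      where
      received : ∀ i → ∃[ j ] optimal j ≡ i × j ∈ interesting i
      received 0F = 0F , ≡.refl , big∈interesting 0F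
      received 1F = 4F , ≡.refl , small∈interesting 1F
      received 2F = 1F , ≡.refl , big∈interesting 2F
      received 3F = 3F , ≡.refl , small∈interesting 3F

    isOPT : IsOPT gapInstance ε
    isOPT = (ε , (optimal , (_ , (1F , ≈-refl) , ε≈utility) ,
                    λ u (i , u≈) → ≤-trans (ε≤optimal i) (≤-reflexive (sym u≈))) , ≈-refl) ,
            λ v (σ , v-min) → minUtility≤ε σ v v-min
      where
      ε≈utility : ε ≈ agentUtility gapInstance optimal 1F
      -- In `optimal`, agent `1F` owns neither `0F` nor `5F`, so the general bound for deprived
      -- agents supplies the upper half.
      ε≈utility = antisym (ε≤optimal 1F)
        (deprived⇒utility≤ε optimal 1F (λ ()) (inj₂ λ ()))

    -- The ratio and the resulting lower bound on the integrality gap.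

    2∈gaps : IntegralityGaps ε 2#
    2∈gaps = 4 , 6 , gapInstance , 2# * ε , ε , isT* , isOPT , 0<ε ,
             sym (x*y/y≈x 2# ε λ ε≈0 → proj₂ 0<ε (sym ε≈0))

mainTheorem5 : ∀ {c ℓ₁ ℓ₂} (F : OrderedField c ℓ₁ ℓ₂) →
    let open OrderedField F
        open MaxMinAllocation F
    in ∀ (ε : Carrier) → 0# < ε → ε ≤ 1# / 2# →
       (Σ[ I ∈ Instance ε 4 6 ] (IsT* I (2# * ε) × IsOPT I ε))
       × 2# ≤sup IntegralityGaps ε
mainTheorem5 F ε 0<ε ε≤½ =
  (gapInstance ε 0<ε ε≤½ , isT* ε 0<ε ε≤½ , isOPT ε 0<ε ε≤½) ,
  -- The ratio `2#` is attained by an instance, so every upper bound of the ratios is at least `2#`.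
  λ _ upper → upper 2# (2∈gaps ε 0<ε ε≤½)
  where
  open OrderedField F using (2#)
  open GapInstance F
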